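{- $\mathrm{NWTL}^++\mathcal{W}$ is exponentially more succinct than $\mathrm{NWTL}^+$: there is a sequence $(\phi_n)_{n\ge1}$ of $\mathrm{NWTL}^++\mathcal{W}$ formulas with $|\phi_n|=O(n)$ such that the smallest $\mathrm{NWTL}^+$ formula equivalent to $\phi_n$ (over nested $\omega$-words over the alphabet $2^{AP}$) has size $2^{\Omega(n)}$.
   Context: Let $AP$ be a finite set of atomic propositions (allowed to grow with $n$) and $\Sigma=2^{AP}$. A matching on $\mathbb{N}$ is a binary relation $\mu$ with unary relations $\mathit{call},\mathit{ret}$ such that: (1) $\mu(i,j)$ implies $\mathit{call}(i)$, $\mathit{ret}(j)$, $i<j$; (2) if $\mu(i,j),\mu(i,j')$ then $j=j'$, and if $\mu(i,j),\mu(i',j)$ then $i=i'$; (3) if $i\le j$, $\mathit{call}(i)$, $\mathit{ret}(j)$ then some $k\in[i,j]$ has $\mu(i,k)$ or $\mu(k,j)$. A nested $\omega$-word is an infinite word $a_1a_2\cdots$ over $\Sigma$ with a matching on $\mathbb{N}$; if $\mu(i,j)$, $i$ is a matched call and $r(i)=j$. $\mathcal{C}(i)$ is the greatest matched call $j<i$ with $r(j)>i$. $\bar w[i,j]$ is the nested subword induced by positions $i..j$ ($j=\infty$: positions $\ge i$). $\mathrm{NWTL}^+$ formulas are built from $\top$, $p\in AP$ (true at $i$ iff $p\in a_i$), $\mathit{call}$, $\mathit{ret}$ using $\neg$, $\vee$, $\bigcirc$ (truth at $i+1$), $\bigcirc_\mu$ (truth at $r(i)$), $\ominus$ (truth at $i-1$,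 $i>1$), $\ominus_\mu$ (truth at the matching call), and until/since for linear paths ($i_{p+1}=i_p+1$), call paths ($i_p=\mathcal{C}(i_{p+1})$), abstract paths ($i_{p+1}=r(i_p)$ if $i_p$ is a matched call, $i_p+1$ if $i_p$ is not a call and $i_p+1$ is not a matched return), and summary paths from $i$ to $j$ ($i_{p+1}=r(i_p)$ if $i_p$ is a matched call with $r(i_p)\le j$, else $i_p+1$); until: for some $j\ge i$ and such a path from $i$ to $j$, $\psi$ at $j$ and $\phi$ at all earlier path positions; since: mirror image. $\mathrm{NWTL}^++\mathcal{W}$ adds: $(\bar w,i)\models\mathcal{W}\phi$ iff $i$ is a call and $(\bar w[i,j],i)\models\phi$ with $j=r(i)$ if $i$ is matched and $j=\infty$ otherwise. Two formulas are equivalent if they have the same models, i.e. the same nested $\omega$-words $\bar w$ with $(\bar w,1)\models$ formula. -}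

module Defs where

open import Data.Nat using (ℕ; zero; suc; _+_; _*_; _^_; _≤_; _<_)
open import Data.Bool using (Bool; true; false)
open import Data.Fin using (Fin)
open import Data.Fin.Subset using (Subset; _∈_)
open import Data.Maybe using (Maybe; just; nothing)
open import Data.Unit using (⊤)
open import Data.Empty using (⊥)
open import Data.Product using (Σ; _×_; _,_)
open import Data.Sum using (_⊎_)
open import Relation.Nullary using (¬_)
open import Relation.Binary.PropositionalEquality using (_≡_)
open import Function.Bundles using (_⇔_)

-- Positions are 0-indexed: position 0 here is position 1 of the paper.
-- Atomic propositions AP = Fin k, alphabet Σ = 2^AP = Subset k.
-- Unary relations call, ret and the binary relation μ are given by
-- their (Boolean) characteristic functions.

record NestedWord (k : ℕ) : Set where
  field
    lab  : ℕ → Subset k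
    call : ℕ → Bool
    ret  : ℕ → Bool
    μ    : ℕ → ℕ → Bool
    μ-call : ∀ i j → μ i j ≡ true → call i ≡ true
    μ-ret  : ∀ i j → μ i j ≡ true → ret j ≡ true
    μ-lt   : ∀ i j → μ i j ≡ true → i < j
    μ-fun  : ∀ i j j' → μ i j ≡ true → μ i j' ≡ true → j ≡ j'
    μ-inj  : ∀ i i' j → μ i j ≡ true → μ i' j ≡ true → i ≡ i'
    μ-cover : ∀ i j → i ≤ j → call i ≡ true → ret j ≡ true →
              Σ ℕ λ m → i ≤ m × m ≤ j × (μ i m ≡ true ⊎ μ m j ≡ true)

open NestedWord public

data PathKind : Set where
  linear callP abstractP summary : PathKind

-- Formulas over AP = Fin k.  The index says whether 𝒲 may occur:
-- Form k false = NWTL⁺,  Form k true = NWTL⁺ + 𝒲.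
data Form (k : ℕ) : Bool → Set where
  ⊤F    : ∀ {b} → Form k b
  prop  : ∀ {b} → Fin k → Form k b
  callF : ∀ {b} → Form k b
  retF  : ∀ {b} → Form k b
  ¬F    : ∀ {b} → Form k b → Form k b
  _∨F_  : ∀ {b} → Form k b → Form k b → Form k b
  ○     : ∀ {b} → Form k b → Form k b
  ○μ    : ∀ {b} → Form k b → Form k b
  ⊖     : ∀ {b} → Form k b → Form k b
  ⊖μ    : ∀ {b} → Form k b → Form k b
  U[_]  : ∀ {b} → PathKind → Form k b → Form k b → Form k b
  S[_]  : ∀ {b} → PathKind → Form k b → Form k b → Form k b
  𝒲     : Form k true → Form k true

size : ∀ {k b} → Form k b → ℕ
size ⊤F = 1
size (prop _) = 1
size callF = 1
size retF = 1
size (¬F φ) = suc (size φ)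
size (φ ∨F ψ) = suc (size φ + size ψ)
size (○ φ) = suc (size φ)
size (○μ φ) = suc (size φ)
size (⊖ φ) = suc (size φ)
size (⊖μ φ) = suc (size φ)
size (U[ _ ] φ ψ) = suc (size φ + size ψ)
size (S[ _ ] φ ψ) = suc (size φ + size ψ)
size (𝒲 φ) = suc (size φ)

-- Upper end of a (nested sub)word: nothing = ∞, just h = last position h.
_≤∞_ : ℕ → Maybe ℕ → Set
i ≤∞ nothing = ⊤
i ≤∞ just h = i ≤ h

data UntilP (Step : ℕ → ℕ → Set) (P Q : ℕ → Set) : ℕ → Set where
  here  : ∀ {i} → Q i → UntilP Step P Q i
  there : ∀ {i j} → P i → Step i j → UntilP Step P Q j → UntilP Step P Q i

data SinceP (Step : ℕ → ℕ → Set) (P Q : ℕ → Set) : ℕ → Set where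
  here  : ∀ {i} → Q i → SinceP Step P Q i
  there : ∀ {i j} → P i → Step j i → SinceP Step P Q j → SinceP Step P Q i

module _ {k : ℕ} (w : NestedWord k) where

  -- Everything below is relative to the nested subword w̄[lo, hi]
  -- (positions lo ≤ i, i ≤∞ hi; matching restricted to it).

  InRange : ℕ → Maybe ℕ → ℕ → Set
  InRange lo hi i = lo ≤ i × i ≤∞ hi

  MatchSub : ℕ → Maybe ℕ → ℕ → ℕ → Set
  MatchSub lo hi i j = lo ≤ i × j ≤∞ hi × μ w i j ≡ true

  MatchedCall : ℕ → Maybe ℕ → ℕ → Set
  MatchedCall lo hi i = Σ ℕ λ j → MatchSub lo hi i j

  MatchedRet : ℕ → Maybe ℕ → ℕ → Set
  MatchedRet lo hi j = Σ ℕ λ i → MatchSub lo hi i j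

  LinStep : ℕ → Maybe ℕ → ℕ → ℕ → Set
  LinStep lo hi x y = InRange lo hi x × InRange lo hi y × y ≡ suc x

  IsCaller : ℕ → Maybe ℕ → ℕ → ℕ → Set
  IsCaller lo hi x y =
    InRange lo hi y × x < y ×
    (Σ ℕ λ r → MatchSub lo hi x r × y < r) ×
    (∀ x' r' → x < x' → x' < y → MatchSub lo hi x' r' → ¬ (y < r'))

  CallStep : ℕ → Maybe ℕ → ℕ → ℕ → Set
  CallStep lo hi x y = IsCaller lo hi x y

  AbsStep : ℕ → Maybe ℕ → ℕ → ℕ → Set
  AbsStep lo hi x y =
    InRange lo hi x × InRange lo hi y ×
    (MatchSub lo hi x y ⊎
     (¬ (call w x ≡ true) × y ≡ suc x × ¬ MatchedRet lo hi y))

  -- summary path (towards target t) step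
  SumStep : ℕ → Maybe ℕ → ℕ → ℕ → ℕ → Set
  SumStep lo hi t x y =
    InRange lo hi x × x < t × t ≤∞ hi ×
    ((MatchSub lo hi x y × y ≤ t) ⊎
     ((∀ r → MatchSub lo hi x r → ¬ (r ≤ t)) × y ≡ suc x))

  StepOf : PathKind → ℕ → Maybe ℕ → ℕ → ℕ → Set
  StepOf linear    = LinStep
  StepOf callP     = CallStep
  StepOf abstractP = AbsStep
  StepOf summary   = λ _ _ _ _ → ⊥   -- unused: summary handled separately

  Sat : ∀ {b} → ℕ → Maybe ℕ → Form k b → ℕ → Set
  Sat lo hi ⊤F i = ⊤
  Sat lo hi (prop p) i = p ∈ lab w i
  Sat lo hi callF i = call w i ≡ true
  Sat lo hi retF i = ret w i ≡ true
  Sat lo hi (¬F φ) i = ¬ Sat lo hi φ i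
  Sat lo hi (φ ∨F ψ) i = Sat lo hi φ i ⊎ Sat lo hi ψ i
  Sat lo hi (○ φ) i = suc i ≤∞ hi × Sat lo hi φ (suc i)
  Sat lo hi (○μ φ) i = Σ ℕ λ j → MatchSub lo hi i j × Sat lo hi φ j
  Sat lo hi (⊖ φ) i = Σ ℕ λ j → i ≡ suc j × lo ≤ j × Sat lo hi φ j
  Sat lo hi (⊖μ φ) i = Σ ℕ λ j → MatchSub lo hi j i × Sat lo hi φ j
  Sat lo hi (U[ summary ] φ ψ) i =
    Σ ℕ λ t → i ≤ t × t ≤∞ hi ×
      UntilP (SumStep lo hi t) (Sat lo hi φ) (λ m → m ≡ t × Sat lo hi ψ m) i
  Sat lo hi (U[ K ] φ ψ) i =
    UntilP (StepOf K lo hi) (Sat lo hi φ) (Sat lo hi ψ) i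
  Sat lo hi (S[ summary ] φ ψ) i =
    SinceP (SumStep lo hi i) (Sat lo hi φ) (Sat lo hi ψ) i
  Sat lo hi (S[ K ] φ ψ) i =
    SinceP (StepOf K lo hi) (Sat lo hi φ) (Sat lo hi ψ) i
  Sat lo hi (𝒲 φ) i =
    call w i ≡ true ×
    ((Σ ℕ λ j → MatchSub lo hi i j × Sat i (just j) φ i)
     ⊎ ((∀ j → ¬ MatchSub lo hi i j) × Sat i hi φ i))

  Models : ∀ {b} → Form k b → Set
  Models φ = Sat 0 nothing φ 0

Equiv : ∀ {k b b'} → Form k b → Form k b' → Set
Equiv {k} φ ψ = (w : NestedWord k) → Models w φ ⇔ Models w ψ

module Submission where

-- On nested words all of whose positions are pending calls, NWTL⁺ collapses to
-- linear temporal logic with past, while 𝒲 still restarts the word at the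
-- current position.  The formula φₙ says that any two positions agreeing on the
-- address bits p₁ … pₙ also agree on p₀: after 𝒲 the earlier position is the
-- first one, hence recognisable as the one with no predecessor.
-- If the subformulas of an NWTL⁺ formula ψ have the same truth values in two models
-- at the two positions around a cut, then exchanging the tails after the cut yields
-- a model again.  There are 2 ^ 2ⁿ tables assigning a value of p₀
-- to each address, so if 4 ^ |ψ| < 2 ^ 2ⁿ then two different tables may be
-- spliced, giving a model of ψ that violates φₙ.

open import Defs
open import Data.Nat using (ℕ; zero; suc; _+_; _*_; _^_; _≤_; _<_; z≤n; s≤s; NonZero;
  _≤‴_; ≤‴-refl; ≤‴-step)
open import Data.Nat.Properties
open import Data.Nat.DivMod using (_mod_; m<n⇒m%n≡m; [m+kn]%n≡m%n)
open import Data.Bool using (Bool; true; false)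
import Data.Bool.Properties as Bool
open import Data.Fin as Fin using (Fin; zero; suc; toℕ; combine; funToFin; finToFun)
open import Data.Fin.Properties using (pigeonhole; 2↔Bool; combine-injective;
  sequence; toℕ-injective; toℕ-fromℕ<; toℕ<n; finToFun-funToFin; funToFin-finToFin)
  renaming (<⇒≢ to Fin-<⇒≢)
open import Data.Fin.Subset using (Subset; _∈_)
open import Data.Fin.Subset.Properties using (_∈?_)
open import Data.Maybe using (nothing)
open import Data.Unit using (⊤; tt)
open import Data.Empty using (⊥)
open import Data.Product using (Σ; ∃₂; _×_; _,_; proj₁; proj₂)
open import Data.Sum as Sum using (_⊎_; inj₁; inj₂)
open import Data.Sum.Function.Propositional using (_⊎-⇔_)
open import Data.Vec using (Vec; []; _∷_; _++_; lookup; tabulate)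
open import Data.Vec.Properties using (lookup∘tabulate; []=⇒lookup; lookup⇒[]=)
open import Data.Vec.Relation.Unary.All using (All; _∷_)
open import Data.Vec.Relation.Unary.All.Properties using (++⁻; lookup⁻)
open import Data.Vec.Functional using (foldr)
open import Effect.Monad using (RawMonad)
open import Function.Base using (_∘_; id)
open import Function.Bundles using (_⇔_; mk⇔; Equivalence; Inverse)
open import Function.Construct.Composition using (_⇔-∘_)
open import Function.Construct.Identity using (⇔-id)
open import Function.Construct.Symmetry using (⇔-sym)
open import Function.Related.TypeIsomorphisms using (¬-cong-⇔)
open import Relation.Nullary using (¬_; Dec; yes; no; does; contradiction)
open import Relation.Nullary.Decidable using (decidable-stable; ¬¬-excluded-middle)
open import Relation.Nullary.Negation using (¬¬-Monad)
open import Relation.Binary.PropositionalEquality using (_≡_; refl; sym; trans; cong; cong₂; subst)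

open Equivalence using (to; from)

private variable
  k n : ℕ

-- Without returns and matches every matching axiom is vacuous. All calls being unmatched, `𝒲`
-- always takes its infinite alternative.
pendingCalls : (ℕ → Subset k) → NestedWord k
pendingCalls l = record
  { lab = l ; call = λ _ → true ; ret = λ _ → false ; μ = λ _ _ → false
  ; μ-call = λ _ _ () ; μ-ret = λ _ _ () ; μ-lt = λ _ _ ()
  ; μ-fun = λ _ _ _ () ; μ-inj = λ _ _ _ () ; μ-cover = λ _ _ _ _ () }

-- Collapse of NWTL⁺ to linear temporal logic

-- The steps surviving on pending calls. A call step needs a match, and an abstract step needs a
-- match or a non-call, so both relations are empty; a summary step can never jump.
Next : PathKind → ℕ → ℕ → Set
Next linear    x y = y ≡ suc x
Next summary   x y = y ≡ suc x
Next callP     x y = ⊥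
Next abstractP x y = ⊥

Next⇒suc : ∀ K {x y} → Next K x y → y ≡ suc x
Next⇒suc linear  eq = eq
Next⇒suc summary eq = eq

Truth : (ℕ → Subset k) → Form k false → ℕ → Set
Truth l ⊤F           i = ⊤
Truth l (prop p)     i = p ∈ l i
Truth l callF        i = ⊤
Truth l retF         i = ⊥
Truth l (¬F φ)       i = ¬ Truth l φ i
Truth l (φ ∨F ψ)     i = Truth l φ i ⊎ Truth l ψ i
Truth l (○ φ)        i = Truth l φ (suc i)
Truth l (○μ φ)       i = ⊥
Truth l (⊖ φ)        i = Σ ℕ λ j → i ≡ suc j × Truth l φ j
Truth l (⊖μ φ)       i = ⊥
Truth l (U[ K ] φ ψ) i = UntilP (Next K) (Truth l φ) (Truth l ψ) i
Truth l (S[ K ] φ ψ) i = SinceP (Next K) (Truth l φ) (Truth l ψ) i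

module _ {R R′ : ℕ → ℕ → Set} {P P′ Q Q′ : ℕ → Set} where

  UntilP-map : (∀ {x y} → R x y → R′ x y) → (∀ {x} → P x → P′ x) → (∀ {x} → Q x → Q′ x) →
               ∀ {i} → UntilP R P Q i → UntilP R′ P′ Q′ i
  UntilP-map f g h (here q)      = here (h q)
  UntilP-map f g h (there p r u) = there (g p) (f r) (UntilP-map f g h u)

  SinceP-map : (∀ {x y} → R x y → R′ x y) → (∀ {x} → P x → P′ x) → (∀ {x} → Q x → Q′ x) →
               ∀ {i} → SinceP R P Q i → SinceP R′ P′ Q′ i
  SinceP-map f g h (here q)      = here (h q)
  SinceP-map f g h (there p r s) = there (g p) (f r) (SinceP-map f g h s)

module _ (l : ℕ → Subset k) where

  private
    w : NestedWord k
    w = pendingCalls l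

  LinStep⇒Next : ∀ {x y} → LinStep w 0 nothing x y → y ≡ suc x
  LinStep⇒Next (_ , _ , eq) = eq

  Next⇒LinStep : ∀ {x y} → y ≡ suc x → LinStep w 0 nothing x y
  Next⇒LinStep eq = (z≤n , tt) , (z≤n , tt) , eq

  CallStep⇒⊥ : ∀ {x y} → CallStep w 0 nothing x y → ⊥
  CallStep⇒⊥ (_ , _ , (_ , (_ , _ , ()) , _) , _)

  AbsStep⇒⊥ : ∀ {x y} → AbsStep w 0 nothing x y → ⊥
  AbsStep⇒⊥ (_ , _ , inj₁ (_ , _ , ()))
  AbsStep⇒⊥ (_ , _ , inj₂ (¬call , _)) = ¬call refl

  SumStep⇒Next : ∀ {t x y} → SumStep w 0 nothing t x y → y ≡ suc x
  SumStep⇒Next (_ , _ , _ , inj₁ ((_ , _ , ()) , _))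
  SumStep⇒Next (_ , _ , _ , inj₂ (_ , eq)) = eq

  Next⇒SumStep : ∀ {t x y} → x < t → y ≡ suc x → SumStep w 0 nothing t x y
  Next⇒SumStep x<t eq = (z≤n , tt) , x<t , tt , inj₂ ((λ _ ()) , eq)

  module _ {P Q : ℕ → Set} where

    -- A summary step mentions the target of the whole path, known only at its end. The recursion
    -- therefore returns `t` from the tail, and the tail's bound `suc i ≤ t` is exactly the
    -- strictness required of the new step.
    summary-until : ∀ {i} → UntilP (Next linear) P Q i →
      Σ ℕ λ t → i ≤ t × ⊤ × UntilP (SumStep w 0 nothing t) P (λ m → m ≡ t × Q m) i
    summary-until (here q) = _ , ≤-refl , tt , here (refl , q)
    summary-until (there p refl u) with summary-until u
    ... | t , i<t , _ , u′ = t , <⇒≤ i<t , tt , there p (Next⇒SumStep i<t refl) u′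

    -- For since, the target is the starting position. It must stay fixed while the recursion moves
    -- left, hence the generalisation to any `t` above `i`.
    summary-since : ∀ {t i} → i ≤ t → SinceP (Next linear) P Q i →
      SinceP (SumStep w 0 nothing t) P Q i
    summary-since i≤t (here q)         = here q
    summary-since i≤t (there p refl s) =
      there p (Next⇒SumStep i≤t refl) (summary-since (<⇒≤ i≤t) s)

  Sat⇒Truth : ∀ φ {i} → Sat w 0 nothing φ i → Truth l φ i
  Truth⇒Sat : ∀ φ {i} → Truth l φ i → Sat w 0 nothing φ i

  Sat⇒Truth ⊤F       s = tt
  Sat⇒Truth (prop p) s = s
  Sat⇒Truth callF    s = tt
  Sat⇒Truth (¬F φ)   s = s ∘ Truth⇒Sat φ
  Sat⇒Truth (φ ∨F ψ) s = Sum.map (Sat⇒Truth φ) (Sat⇒Truth ψ) s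
  Sat⇒Truth (○ φ)    (_ , s) = Sat⇒Truth φ s
  Sat⇒Truth (○μ φ)   (_ , (_ , _ , ()) , _)
  Sat⇒Truth (⊖ φ)    (j , eq , _ , s) = j , eq , Sat⇒Truth φ s
  Sat⇒Truth (⊖μ φ)   (_ , (_ , _ , ()) , _)
  Sat⇒Truth (U[ linear ]    φ ψ) = UntilP-map LinStep⇒Next (Sat⇒Truth φ) (Sat⇒Truth ψ)
  Sat⇒Truth (U[ callP ]     φ ψ) = UntilP-map CallStep⇒⊥ (Sat⇒Truth φ) (Sat⇒Truth ψ)
  Sat⇒Truth (U[ abstractP ] φ ψ) = UntilP-map AbsStep⇒⊥ (Sat⇒Truth φ) (Sat⇒Truth ψ)
  Sat⇒Truth (U[ summary ]   φ ψ) (_ , _ , _ , u) =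
    UntilP-map SumStep⇒Next (Sat⇒Truth φ) (Sat⇒Truth ψ ∘ proj₂) u
  Sat⇒Truth (S[ linear ]    φ ψ) = SinceP-map LinStep⇒Next (Sat⇒Truth φ) (Sat⇒Truth ψ)
  Sat⇒Truth (S[ callP ]     φ ψ) = SinceP-map CallStep⇒⊥ (Sat⇒Truth φ) (Sat⇒Truth ψ)
  Sat⇒Truth (S[ abstractP ] φ ψ) = SinceP-map AbsStep⇒⊥ (Sat⇒Truth φ) (Sat⇒Truth ψ)
  Sat⇒Truth (S[ summary ]   φ ψ) = SinceP-map SumStep⇒Next (Sat⇒Truth φ) (Sat⇒Truth ψ)

  Truth⇒Sat ⊤F       s = tt
  Truth⇒Sat (prop p) s = s
  Truth⇒Sat callF    s = refl
  Truth⇒Sat (¬F φ)   s = s ∘ Sat⇒Truth φ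
  Truth⇒Sat (φ ∨F ψ) s = Sum.map (Truth⇒Sat φ) (Truth⇒Sat ψ) s
  Truth⇒Sat (○ φ)    s = tt , Truth⇒Sat φ s
  Truth⇒Sat (⊖ φ)    (j , eq , s) = j , eq , z≤n , Truth⇒Sat φ s
  Truth⇒Sat (U[ linear ]    φ ψ) = UntilP-map Next⇒LinStep (Truth⇒Sat φ) (Truth⇒Sat ψ)
  Truth⇒Sat (U[ callP ]     φ ψ) = UntilP-map (λ ()) (Truth⇒Sat φ) (Truth⇒Sat ψ)
  Truth⇒Sat (U[ abstractP ] φ ψ) = UntilP-map (λ ()) (Truth⇒Sat φ) (Truth⇒Sat ψ)
  Truth⇒Sat (U[ summary ]   φ ψ) u =
    summary-until (UntilP-map id (Truth⇒Sat φ) (Truth⇒Sat ψ) u)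
  Truth⇒Sat (S[ linear ]    φ ψ) = SinceP-map Next⇒LinStep (Truth⇒Sat φ) (Truth⇒Sat ψ)
  Truth⇒Sat (S[ callP ]     φ ψ) = SinceP-map (λ ()) (Truth⇒Sat φ) (Truth⇒Sat ψ)
  Truth⇒Sat (S[ abstractP ] φ ψ) = SinceP-map (λ ()) (Truth⇒Sat φ) (Truth⇒Sat ψ)
  Truth⇒Sat (S[ summary ]   φ ψ) s =
    summary-since ≤-refl (SinceP-map id (Truth⇒Sat φ) (Truth⇒Sat ψ) s)

-- Splicing two words

-- Repetitions are kept so that the length is `size φ` by construction; this length is the exponent
-- in the count of types.
subformulas : (φ : Form k false) → Vec (Form k false) (size φ)
subformulas ⊤F             = ⊤F ∷ []
subformulas (prop p)       = prop p ∷ []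
subformulas callF          = callF ∷ []
subformulas retF           = retF ∷ []
subformulas (¬F φ)         = ¬F φ ∷ subformulas φ
subformulas (φ ∨F ψ)       = (φ ∨F ψ) ∷ subformulas φ ++ subformulas ψ
subformulas (○ φ)          = ○ φ ∷ subformulas φ
subformulas (○μ φ)         = ○μ φ ∷ subformulas φ
subformulas (⊖ φ)          = ⊖ φ ∷ subformulas φ
subformulas (⊖μ φ)         = ⊖μ φ ∷ subformulas φ
subformulas (U[ K ] φ ψ)   = U[ K ] φ ψ ∷ subformulas φ ++ subformulas ψ
subformulas (S[ K ] φ ψ)   = S[ K ] φ ψ ∷ subformulas φ ++ subformulas ψ

self∈subformulas : ∀ {P : Form k false → Set} φ → All P (subformulas φ) → P φ
self∈subformulas ⊤F           (p ∷ _) = p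
self∈subformulas (prop _)     (p ∷ _) = p
self∈subformulas callF        (p ∷ _) = p
self∈subformulas retF         (p ∷ _) = p
self∈subformulas (¬F _)       (p ∷ _) = p
self∈subformulas (_ ∨F _)     (p ∷ _) = p
self∈subformulas (○ _)        (p ∷ _) = p
self∈subformulas (○μ _)       (p ∷ _) = p
self∈subformulas (⊖ _)        (p ∷ _) = p
self∈subformulas (⊖μ _)       (p ∷ _) = p
self∈subformulas (U[ _ ] _ _) (p ∷ _) = p
self∈subformulas (S[ _ ] _ _) (p ∷ _) = p

-- Past operators look across the cut at `c`, future operators at `suc c`.
Agree : ℕ → (u v : ℕ → Subset k) → Form k false → Set
Agree c u v φ = (Truth u φ c ⇔ Truth v φ c) × (Truth u φ (suc c) ⇔ Truth v φ (suc c))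

module _ {R : ℕ → ℕ → Set} (R⇒suc : ∀ {x y} → R x y → y ≡ suc x) (c : ℕ)
         {P P′ Q Q′ : ℕ → Set} where

  -- With unit steps, a path from the left either ends there or visits `suc c`, where the third
  -- argument replaces its whole remainder. `SinceP-right` is the mirror image, with handover at
  -- `c`.
  UntilP-left : (∀ {i} → i ≤ c → P i → P′ i) → (∀ {i} → i ≤ c → Q i → Q′ i) →
    (UntilP R P Q (suc c) → UntilP R P′ Q′ (suc c)) →
    ∀ {i} → i ≤ c → UntilP R P Q i → UntilP R P′ Q′ i
  UntilP-left f g h i≤c (here q) = here (g i≤c q)
  UntilP-left f g h i≤c (there p r u) with R⇒suc r | m≤n⇒m<n∨m≡n i≤c
  ... | refl | inj₁ i<c  = there (f i≤c p) r (UntilP-left f g h i<c u)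
  ... | refl | inj₂ refl = there (f i≤c p) r (h u)

  UntilP-right : (∀ {i} → c < i → P i → P′ i) → (∀ {i} → c < i → Q i → Q′ i) →
    ∀ {i} → c < i → UntilP R P Q i → UntilP R P′ Q′ i
  UntilP-right f g c<i (here q) = here (g c<i q)
  UntilP-right f g c<i (there p r u) with R⇒suc r
  ... | refl = there (f c<i p) r (UntilP-right f g (m≤n⇒m≤1+n c<i) u)

  SinceP-left : (∀ {i} → i ≤ c → P i → P′ i) → (∀ {i} → i ≤ c → Q i → Q′ i) →
    ∀ {i} → i ≤ c → SinceP R P Q i → SinceP R P′ Q′ i
  SinceP-left f g i≤c (here q) = here (g i≤c q)
  SinceP-left f g i≤c (there p r s) with R⇒suc r
  ... | refl = there (f i≤c p) r (SinceP-left f g (<⇒≤ i≤c) s)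

  SinceP-right : (∀ {i} → c < i → P i → P′ i) → (∀ {i} → c < i → Q i → Q′ i) →
    (SinceP R P Q c → SinceP R P′ Q′ c) →
    ∀ {i} → c < i → SinceP R P Q i → SinceP R P′ Q′ i
  SinceP-right f g h c<i (here q) = here (g c<i q)
  SinceP-right f g h c<i (there p r s) with R⇒suc r
  ... | refl with m≤n⇒m<n∨m≡n (≤-pred c<i)
  ...   | inj₁ c<j  = there (f c<i p) r (SinceP-right f g h c<j s)
  ...   | inj₂ refl = there (f c<i p) r (h s)

module _ {A : Set} (c : ℕ) (u v : ℕ → A) where

  splice : ℕ → A
  splice i with i ≤? c
  ... | yes _ = u i
  ... | no  _ = v i

  splice-left : ∀ {i} → i ≤ c → splice i ≡ u i
  splice-left {i} i≤c with i ≤? c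
  ... | yes _   = refl
  ... | no  i≰c = contradiction i≤c i≰c

  splice-right : ∀ {i} → c < i → splice i ≡ v i
  splice-right {i} c<i with i ≤? c
  ... | yes i≤c = contradiction c<i (≤⇒≯ i≤c)
  ... | no  _   = refl

module _ (c : ℕ) (u v : ℕ → Subset k) where

  Glued : Form k false → Set
  Glued φ = (∀ {i} → i ≤ c → Truth (splice c u v) φ i ⇔ Truth u φ i)
          × (∀ {i} → c < i → Truth (splice c u v) φ i ⇔ Truth v φ i)

  glued₂ : ∀ φ ψ → (All (Agree c u v) (subformulas φ) → Glued φ) →
    (All (Agree c u v) (subformulas ψ) → Glued ψ) →
    All (Agree c u v) (subformulas φ ++ subformulas ψ) → Glued φ × Glued ψ
  glued₂ φ ψ f g as with ++⁻ (subformulas φ) as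
  ... | bs , cs = f bs , g cs

  -- For each temporal operator one side never looks across the cut and follows by induction. The
  -- other side needs one truth value from across the cut, which agreement transfers between `u` and
  -- `v`: that of the operand for `○` and `⊖`, that of the formula itself for `U` and `S`.
  glued : ∀ φ → All (Agree c u v) (subformulas φ) → Glued φ
  glued ⊤F       _ = (λ _ → ⇔-id _) , (λ _ → ⇔-id _)
  glued (prop p) _ =
      (λ i≤c → ∈-cong (splice-left c u v i≤c)) , (λ c<i → ∈-cong (splice-right c u v c<i))
    where
    ∈-cong : ∀ {xs ys} → xs ≡ ys → p ∈ xs ⇔ p ∈ ys
    ∈-cong refl = ⇔-id _
  glued callF    _ = (λ _ → ⇔-id _) , (λ _ → ⇔-id _)
  glued retF     _ = (λ _ → ⇔-id _) , (λ _ → ⇔-id _)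
  glued (¬F φ)   (_ ∷ as) with glued φ as
  ... | l , r = (λ i≤c → ¬-cong-⇔ (l i≤c)) , (λ c<i → ¬-cong-⇔ (r c<i))
  glued (φ ∨F ψ) (_ ∷ as) with glued₂ φ ψ (glued φ) (glued ψ) as
  ... | (l , r) , (l′ , r′) = (λ i≤c → l i≤c ⊎-⇔ l′ i≤c) , (λ c<i → r c<i ⊎-⇔ r′ c<i)
  glued (○ φ)    (_ ∷ as) with glued φ as | self∈subformulas φ as
  ... | l , r | _ , agree = left , (λ c<i → r (m≤n⇒m≤1+n c<i))
    where
    left : ∀ {i} → i ≤ c → Truth (splice c u v) φ (suc i) ⇔ Truth u φ (suc i)
    left i≤c with m≤n⇒m<n∨m≡n i≤c
    ... | inj₁ i<c  = l i<c
    ... | inj₂ refl = ⇔-sym agree ⇔-∘ r ≤-refl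
  glued (○μ φ)   _ = (λ _ → ⇔-id _) , (λ _ → ⇔-id _)
  glued (⊖ φ)    (_ ∷ as) with glued φ as | self∈subformulas φ as
  ... | l , r | agree , _ =
      (λ i≤c → mk⇔ (λ { (j , refl , t) → j , refl , to (l (<⇒≤ i≤c)) t })
                   (λ { (j , refl , t) → j , refl , from (l (<⇒≤ i≤c)) t }))
    , (λ c<i → mk⇔ (λ { (j , refl , t) → j , refl , to (right (≤-pred c<i)) t })
                   (λ { (j , refl , t) → j , refl , from (right (≤-pred c<i)) t }))
    where
    right : ∀ {j} → c ≤ j → Truth (splice c u v) φ j ⇔ Truth v φ j
    right c≤j with m≤n⇒m<n∨m≡n c≤j
    ... | inj₁ c<j  = r c<j
    ... | inj₂ refl = agree ⇔-∘ l ≤-refl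
  glued (⊖μ φ)   _ = (λ _ → ⇔-id _) , (λ _ → ⇔-id _)
  glued (U[ K ] φ ψ) ((_ , agree) ∷ as) with glued₂ φ ψ (glued φ) (glued ψ) as
  ... | (l , r) , (l′ , r′) =
      (λ i≤c → mk⇔
        (UntilP-left (Next⇒suc K) c (to ∘ l) (to ∘ l′) (from agree ∘ to (right ≤-refl)) i≤c)
        (UntilP-left (Next⇒suc K) c (from ∘ l) (from ∘ l′) (from (right ≤-refl) ∘ to agree) i≤c))
    , right
    where
    right : ∀ {i} → c < i → Truth (splice c u v) (U[ K ] φ ψ) i ⇔ Truth v (U[ K ] φ ψ) i
    right c<i = mk⇔ (UntilP-right (Next⇒suc K) c (to ∘ r) (to ∘ r′) c<i)
                    (UntilP-right (Next⇒suc K) c (from ∘ r) (from ∘ r′) c<i)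
  glued (S[ K ] φ ψ) ((agree , _) ∷ as) with glued₂ φ ψ (glued φ) (glued ψ) as
  ... | (l , r) , (l′ , r′) =
      left
    , (λ c<i → mk⇔
        (SinceP-right (Next⇒suc K) c (to ∘ r) (to ∘ r′) (to agree ∘ to (left ≤-refl)) c<i)
        (SinceP-right (Next⇒suc K) c (from ∘ r) (from ∘ r′) (from (left ≤-refl) ∘ from agree) c<i))
    where
    left : ∀ {i} → i ≤ c → Truth (splice c u v) (S[ K ] φ ψ) i ⇔ Truth u (S[ K ] φ ψ) i
    left i≤c = mk⇔ (SinceP-left (Next⇒suc K) c (to ∘ l) (to ∘ l′) i≤c)
                   (SinceP-left (Next⇒suc K) c (from ∘ l) (from ∘ l′) i≤c)

  splice-models : ∀ φ → All (Agree c u v) (subformulas φ) →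
    Models (pendingCalls u) φ → Models (pendingCalls (splice c u v)) φ
  splice-models φ as =
    Truth⇒Sat _ φ ∘ from (proj₁ (glued φ as) z≤n) ∘ Sat⇒Truth _ φ

-- Counting types

decBit : ∀ {A : Set} → Dec A → Fin 2
decBit a? = Inverse.from 2↔Bool (does a?)

decBit-injective : ∀ {A B : Set} (a? : Dec A) (b? : Dec B) → decBit a? ≡ decBit b? → A ⇔ B
decBit-injective (yes a) (yes b) _ = mk⇔ (λ _ → b) (λ _ → a)
decBit-injective (no ¬a) (no ¬b) _ = mk⇔ (λ a → contradiction a ¬a) (λ b → contradiction b ¬b)

-- Truth over infinite words is undecidable, but the finitely many truth values
-- involved can be decided simultaneously under a double negation.
agreeing-pair : ∀ {m} (ψ : Form k false) (word : Fin m → ℕ → Subset k) (c : ℕ) →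
  4 ^ size ψ < m →
  ¬ ¬ (∃₂ λ S T → S Fin.< T × All (Agree c (word S) (word T)) (subformulas ψ))
agreeing-pair {k} {m} ψ word c few ¬pair =
  sequence rawApplicative (λ S → sequence rawApplicative (λ x → decide S x)) λ d →
  -- Each listed subformula contributes one base-4 digit, combining its truth values at `c` and at
  -- `suc c`.
  let code : Fin m → Fin (4 ^ size ψ)
      code S = funToFin (λ x → combine (decBit (proj₁ (d S x))) (decBit (proj₂ (d S x))))
      S , T , S<T , eq = pigeonhole few code
  in ¬pair (S , T , S<T , lookup⁻ (λ x →
       let eqs = combine-injective _ _ _ _
                   (trans (sym (finToFun-funToFin _ x))
                     (trans (cong (λ f → finToFun f x) eq) (finToFun-funToFin _ x)))
       in decBit-injective (proj₁ (d S x)) (proj₁ (d T x)) (proj₁ eqs)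
        , decBit-injective (proj₂ (d S x)) (proj₂ (d T x)) (proj₂ eqs)))
  where
  open RawMonad ¬¬-Monad using (rawApplicative)
  Decided : Fin m → Fin (size ψ) → Set
  Decided S x = Dec (Truth (word S) (lookup (subformulas ψ) x) c)
              × Dec (Truth (word S) (lookup (subformulas ψ) x) (suc c))
  decide : ∀ S x → ¬ ¬ Decided S x
  decide S x ¬d = ¬¬-excluded-middle λ a? → ¬¬-excluded-middle λ b? → ¬d (a? , b?)

-- The succinct formulas

always : Form k true → Form k true
always χ = ¬F (U[ linear ] ⊤F (¬F χ))

-- The since may stop only where `⊖ ⊤F` fails. Since `⊖` respects the lower end of the subword,
-- inside `𝒲` this is the position at which `𝒲` was evaluated.
atFirst : Fin k → Form k true
atFirst p = S[ linear ] ⊤F (¬F (⊖ ⊤F ∨F ¬F (prop p)))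

sameAsFirst : Fin k → Form k true
sameAsFirst p = ¬F (prop p ∨F atFirst p) ∨F ¬F (¬F (prop p) ∨F ¬F (atFirst p))

-- A material implication from the address bits, propositions `suc b`, to the value bit, proposition
-- `zero`.
keyDetermines : ∀ n → Form (suc n) true
keyDetermines n = foldr _∨F_ (sameAsFirst zero) {n} (λ b → ¬F (sameAsFirst (suc b)))

-- The outer `always` ranges over the earlier position, `𝒲` makes it first, and the inner `always`
-- ranges over the later one. Equality being symmetric, ordered pairs suffice.
functional : ∀ n → Form (suc n) true
functional n = always (𝒲 (always (keyDetermines n)))

size-foldr-∨ : ∀ {b m} (χ : Form k b) q (φs : Fin m → Form k b) → (∀ x → size (φs x) ≡ q) →
  size (foldr _∨F_ χ φs) ≡ m * suc q + size χ
size-foldr-∨ {m = zero}  χ q φs eq = refl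
size-foldr-∨ {m = suc m} χ q φs eq =
  cong suc (trans (cong₂ _+_ (eq zero) (size-foldr-∨ χ q (φs ∘ suc) (eq ∘ suc)))
                  (sym (+-assoc q (m * suc q) (size χ))))

size-functional : ∀ n → 1 ≤ n → size (functional n) ≤ 61 * n
size-functional n 1≤n = begin
  -- Each `always` costs 4 and `𝒲` costs 1. `sameAsFirst` has size 25, so a negated copy together
  -- with its disjunction costs 27. Finally 34 = 25 + 9 and 61 = 27 + 34.
  9 + size (keyDetermines n)  ≡⟨ cong (9 +_) (size-foldr-∨ (sameAsFirst zero) 26
                                   (λ (b : Fin n) → ¬F (sameAsFirst (suc b))) (λ _ → refl)) ⟩
  9 + (n * 27 + 25)           ≡⟨ trans (+-comm 9 _) (+-assoc (n * 27) 25 9) ⟩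
  n * 27 + 34 * 1             ≤⟨ +-monoʳ-≤ (n * 27) (*-monoʳ-≤ 34 1≤n) ⟩
  n * 27 + 34 * n             ≡⟨ cong (_+ 34 * n) (*-comm n 27) ⟩
  27 * n + 34 * n             ≡⟨ *-distribʳ-+ n 27 34 ⟨
  61 * n                      ∎
  where open ≤-Reasoning

Functional : (ℕ → Subset (suc n)) → Set
Functional l = ∀ i j → i ≤ j →
  (∀ b → lookup (l j) (suc b) ≡ lookup (l i) (suc b)) → lookup (l j) zero ≡ lookup (l i) zero

∈⇔lookup : (p : Fin k) (xs : Subset k) → p ∈ xs ⇔ lookup xs p ≡ true
∈⇔lookup p xs = mk⇔ []=⇒lookup (lookup⇒[]= p xs)

-- The left-hand side is what `Sat` yields for `sameAsFirst`. Case analysis on the Booleans takes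
-- the place of excluded middle.
⇔-reflects-≡ : ∀ {A B : Set} {a b} → A ⇔ a ≡ true → B ⇔ b ≡ true →
  (¬ (A ⊎ B) ⊎ ¬ (¬ A ⊎ ¬ B)) ⇔ a ≡ b
⇔-reflects-≡ {a = a} {b} A⇔ B⇔ = mk⇔ (f a b A⇔ B⇔) (g A⇔ B⇔)
  where
  f : ∀ {A B : Set} a b → A ⇔ a ≡ true → B ⇔ b ≡ true → ¬ (A ⊎ B) ⊎ ¬ (¬ A ⊎ ¬ B) → a ≡ b
  f false false _ _ _ = refl
  f true  true  _ _ _ = refl
  f false true A⇔ B⇔ (inj₁ h) = contradiction (inj₂ (from B⇔ refl)) h
  f false true A⇔ B⇔ (inj₂ h) = contradiction (inj₁ (λ x → contradiction (to A⇔ x) λ ())) h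
  f true false A⇔ B⇔ (inj₁ h) = contradiction (inj₁ (from A⇔ refl)) h
  f true false A⇔ B⇔ (inj₂ h) = contradiction (inj₂ (λ x → contradiction (to B⇔ x) λ ())) h
  g : ∀ {A B : Set} {a b} → A ⇔ a ≡ true → B ⇔ b ≡ true → a ≡ b → ¬ (A ⊎ B) ⊎ ¬ (¬ A ⊎ ¬ B)
  g {a = true} A⇔ B⇔ refl =
    inj₂ Sum.[ (λ ¬x → ¬x (from A⇔ refl)) , (λ ¬y → ¬y (from B⇔ refl)) ]
  g {a = false} A⇔ B⇔ refl =
    inj₁ Sum.[ (λ x → contradiction (to A⇔ x) λ ()) , (λ y → contradiction (to B⇔ y) λ ()) ]

module _ (l : ℕ → Subset k) where

  private
    w : NestedWord k
    w = pendingCalls l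

  until-linear : ∀ {P Q : ℕ → Set} {lo i j} → lo ≤ i → i ≤ j → (∀ m → P m) → Q j →
    UntilP (LinStep w lo nothing) P Q i
  -- The order `≤‴` recurses by raising its lower end, just as the path advances towards a fixed
  -- `j`.
  until-linear {P} {Q} {lo} {j = j} lo≤i i≤j p q = go lo≤i (≤⇒≤‴ i≤j)
    where
    go : ∀ {i} → lo ≤ i → i ≤‴ j → UntilP (LinStep w lo nothing) P Q i
    go lo≤i ≤‴-refl = here q
    go lo≤i (≤‴-step i<j) =
      there (p _) ((lo≤i , tt) , (m≤n⇒m≤1+n lo≤i , tt) , refl) (go (m≤n⇒m≤1+n lo≤i) i<j)

  until-linear⁻ : ∀ {P Q : ℕ → Set} {lo i} → UntilP (LinStep w lo nothing) P Q i →
    Σ ℕ λ j → i ≤ j × Q j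
  until-linear⁻ (here q) = _ , ≤-refl , q
  until-linear⁻ (there _ (_ , _ , refl) u) with until-linear⁻ u
  ... | j , i<j , q = j , <⇒≤ i<j , q

  -- The double negation remains because `always` is a negated until of a negation; it is removed
  -- later, where the conclusion is decidable.
  sat-always : ∀ (χ : Form k true) {lo i} → lo ≤ i →
    Sat w lo nothing (always χ) i ⇔ (∀ j → i ≤ j → ¬ ¬ Sat w lo nothing χ j)
  sat-always χ lo≤i = mk⇔
    (λ s j i≤j ¬χ → s (until-linear lo≤i i≤j _ ¬χ))
    (λ h u → let j , i≤j , ¬χ = until-linear⁻ u in h j i≤j ¬χ)

  sat-atFirst : ∀ p {i j} → i ≤ j → Sat w i nothing (atFirst p) j ⇔ p ∈ l i
  sat-atFirst p {i} i≤j = mk⇔ (forth i≤j) (λ p∈ → back p∈ i≤j)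
    where
    forth : ∀ {j} → i ≤ j → Sat w i nothing (atFirst p) j → p ∈ l i
    forth i≤j (there _ ((i≤j′ , _) , _) s) = forth i≤j′ s
    forth i≤j (here q) with m≤n⇒m<n∨m≡n i≤j
    -- Beyond `i` the predecessor is still in range, so `⊖ ⊤F` holds and the since cannot stop here.
    ... | inj₁ (s≤s i≤j′) = contradiction (inj₁ (_ , refl , i≤j′ , tt)) q
    ... | inj₂ refl = decidable-stable (p ∈? l i) (q ∘ inj₂)
    first : p ∈ l i → Sat w i nothing (atFirst p) i
    first p∈ = here λ { (inj₁ (_ , refl , i≤j , _)) → 1+n≰n i≤j ; (inj₂ p∉) → p∉ p∈ }
    back : p ∈ l i → ∀ {j} → i ≤ j → Sat w i nothing (atFirst p) j
    back p∈ i≤j with m≤n⇒m<n∨m≡n i≤j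
    ... | inj₂ refl = first p∈
    ... | inj₁ (s≤s i≤j′) = there tt ((i≤j′ , tt) , (i≤j , tt) , refl) (back p∈ i≤j′)

  sat-sameAsFirst : ∀ p {i j} → i ≤ j →
    Sat w i nothing (sameAsFirst p) j ⇔ lookup (l j) p ≡ lookup (l i) p
  sat-sameAsFirst p i≤j =
    ⇔-reflects-≡ (∈⇔lookup p _) (∈⇔lookup p _ ⇔-∘ sat-atFirst p i≤j)

  sat-foldr-∨ : ∀ {b lo hi i m} (χ : Form k b) (φs : Fin m → Form k b) →
    Sat w lo hi (foldr _∨F_ χ φs) i ⇔ ((Σ (Fin m) λ x → Sat w lo hi (φs x) i) ⊎ Sat w lo hi χ i)
  sat-foldr-∨ {m = zero} χ φs = mk⇔ inj₂ λ { (inj₁ (() , _)) ; (inj₂ s) → s }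
  sat-foldr-∨ {m = suc m} χ φs = mk⇔
    (λ { (inj₁ s) → inj₁ (zero , s)
       ; (inj₂ s) → Sum.map₁ (λ (x , t) → suc x , t) (to (sat-foldr-∨ χ (φs ∘ suc)) s) })
    (λ { (inj₁ (zero , s)) → inj₁ s
       ; (inj₁ (suc x , s)) → inj₂ (from (sat-foldr-∨ χ (φs ∘ suc)) (inj₁ (x , s)))
       ; (inj₂ s) → inj₂ (from (sat-foldr-∨ χ (φs ∘ suc)) (inj₂ s)) })

models-functional : (l : ℕ → Subset (suc n)) → Models (pendingCalls l) (functional n) ⇔ Functional l
models-functional {n} l = mk⇔ forth back
  where
  w : NestedWord (suc n)
  w = pendingCalls l
  key⇔ : ∀ {i j} → Sat w i nothing (keyDetermines n) j ⇔
    ((Σ (Fin n) λ b → ¬ Sat w i nothing (sameAsFirst (suc b)) j) ⊎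
     Sat w i nothing (sameAsFirst zero) j)
  key⇔ = sat-foldr-∨ l (sameAsFirst zero) (λ b → ¬F (sameAsFirst (suc b)))
  forth : Models w (functional n) → Functional l
  forth s i j i≤j same = decidable-stable (_ Bool.≟ _) λ differ →
    to (sat-always l (𝒲 (always (keyDetermines n))) z≤n) s i z≤n λ
      { (_ , inj₁ (_ , (_ , _ , ()) , _))
      ; (_ , inj₂ (_ , t)) → to (sat-always l (keyDetermines n) ≤-refl) t j i≤j λ key →
          Sum.[ (λ (b , ¬same) → ¬same (from (sat-sameAsFirst l (suc b) i≤j) (same b)))
              , (λ same₀ → differ (to (sat-sameAsFirst l zero i≤j) same₀)) ]′
              (to key⇔ key) }
  back : Functional l → Models w (functional n)
  back fun = from (sat-always l (𝒲 (always (keyDetermines n))) z≤n) λ i _ ¬𝒲 →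
    ¬𝒲 (refl , inj₂ ((λ { _ (_ , _ , ()) }) ,
      from (sat-always l (keyDetermines n) ≤-refl) λ j i≤j ¬key →
        let ¬key′ = ¬key ∘ from key⇔ in
        ¬key′ (inj₂ (from (sat-sameAsFirst l zero i≤j) (fun i j i≤j λ b →
          decidable-stable (_ Bool.≟ _) λ differ →
            ¬key′ (inj₁ (b , λ same → differ (to (sat-sameAsFirst l (suc b) i≤j) same))))))))

-- Words listing a table

bit : Fin 2 → Bool
bit = Inverse.to 2↔Bool

bit-injective : ∀ {x y} → bit x ≡ bit y → x ≡ y
bit-injective {x} {y} eq = trans (sym (Inverse.strictlyInverseʳ 2↔Bool x))
  (trans (cong (Inverse.from 2↔Bool) eq) (Inverse.strictlyInverseʳ 2↔Bool y))

funToFin-cong : ∀ {m n} {f g : Fin m → Fin n} → (∀ i → f i ≡ g i) → funToFin {m} {n} f ≡ funToFin g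
funToFin-cong {zero}  eq = refl
funToFin-cong {suc m} eq = cong₂ combine (eq zero) (funToFin-cong {m} (eq ∘ suc))

finToFun-injective : ∀ {m n} {x y : Fin (m ^ n)} → (∀ i → finToFun x i ≡ finToFun y i) → x ≡ y
finToFun-injective {m} {n} {x} {y} eq = trans (sym (funToFin-finToFin {n} {m} x))
  (trans (funToFin-cong {n} {m} eq) (funToFin-finToFin {n} {m} y))

mod-toℕ : ∀ {m} .{{_ : NonZero m}} (x : Fin m) q → (toℕ x + q * m) mod m ≡ x
mod-toℕ {m} x q = toℕ-injective (trans (toℕ-fromℕ< _)
  (trans ([m+kn]%n≡m%n (toℕ x) q m) (m<n⇒m%n≡m (toℕ<n x))))

-- `S` codes a table from `n`-bit addresses to bits, so tables are already numbered for the
-- pigeonhole principle.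
row : ∀ n → Fin (2 ^ 2 ^ n) → Fin (2 ^ n) → Subset (suc n)
row n S a = bit (finToFun S a) ∷ tabulate (λ b → bit (finToFun a b))

-- Repeating the table periodically puts every address on both sides of the cut at `2 ^ n`.
tableWord : ∀ n → Fin (2 ^ 2 ^ n) → ℕ → Subset (suc n)
tableWord n S i = row n S ((i mod 2 ^ n) {{m^n≢0 2 n}})

tableWord-functional : ∀ n S → Functional (tableWord n S)
tableWord-functional n S i j _ same =
  cong (bit ∘ finToFun S) (finToFun-injective {2} {n} λ b → bit-injective
    (trans (sym (lookup∘tabulate _ b)) (trans (same b) (lookup∘tabulate _ b))))

-- Address `x` occurs left of the cut with its value in `S` and right of it with its value in `T`;
-- functionality equates the two values.
spliced-functional : ∀ n (S T : Fin (2 ^ 2 ^ n)) →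
  Functional (splice (2 ^ n) (tableWord n S) (tableWord n T)) → S ≡ T
spliced-functional n S T fun = finToFun-injective {2} {2 ^ n} λ x → bit-injective
  (sym (trans (cong (λ r → lookup r zero) (sym (at-right x)))
    (trans (fun _ _ (+-monoʳ-≤ (toℕ x) z≤n) λ b →
             trans (cong (λ r → lookup r (suc b)) (at-right x))
                   (cong (λ r → lookup r (suc b)) (sym (at-left x))))
           (cong (λ r → lookup r zero) (at-left x)))))
  where
  w : ℕ → Subset (suc n)
  w = splice (2 ^ n) (tableWord n S) (tableWord n T)
  at-left : ∀ x → w (toℕ x + 0 * 2 ^ n) ≡ row n S x
  at-left x = trans
    (splice-left (2 ^ n) (tableWord n S) (tableWord n T)
      (≤-trans (≤-reflexive (+-identityʳ (toℕ x))) (<⇒≤ (toℕ<n x))))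
    (cong (row n S) (mod-toℕ {{m^n≢0 2 n}} x 0))
  -- One period would not do: for `x` zero it gives position `2 ^ n`, which `splice` still takes
  -- from the left word.
  at-right : ∀ x → w (toℕ x + 2 * 2 ^ n) ≡ row n T x
  at-right x = trans
    (splice-right (2 ^ n) (tableWord n S) (tableWord n T)
      (<-≤-trans (m<m*n (2 ^ n) 2 {{m^n≢0 2 n}} (s≤s (s≤s z≤n)))
        (≤-trans (≤-reflexive (*-comm (2 ^ n) 2)) (m≤n+m _ (toℕ x)))))
    (cong (row n T) (mod-toℕ {{m^n≢0 2 n}} x 2))

-- As `4 ^ s` is `2 ^ (2 * s)`, comparing exponents suffices. For `s` at least 2, `2 * s` is at most
-- the square of `s`; for smaller `s` it is at most 2, below `2 ^ n` because `2 ≤ n`.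
few-types : ∀ n s → 2 ≤ n → ¬ (2 ^ n ≤ s ^ 2) → 4 ^ s < 2 ^ 2 ^ n
few-types n s 2≤n large =
  subst (_< 2 ^ 2 ^ n) (sym (^-*-assoc 2 2 s)) (^-monoʳ-< 2 (s≤s (s≤s z≤n)) 2s<2^n)
  where
  open ≤-Reasoning
  2s<2^n : 2 * s < 2 ^ n
  2s<2^n with ≤-<-connex 2 s
  ... | inj₁ 2≤s = begin-strict
    2 * s  ≤⟨ *-monoˡ-≤ s 2≤s ⟩
    s * s  ≡⟨ cong (s *_) (*-identityʳ s) ⟨
    s ^ 2  <⟨ ≰⇒> large ⟩
    2 ^ n  ∎
  ... | inj₂ s<2 = begin-strict
    2 * s  ≤⟨ *-monoʳ-≤ 2 (≤-pred s<2) ⟩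
    2      <⟨ s≤s (s≤s (s≤s z≤n)) ⟩
    2 ^ 2  ≤⟨ ^-monoʳ-≤ 2 2≤n ⟩
    2 ^ n  ∎

theorem5p6 : Σ (ℕ → ℕ) λ ap → Σ ((n : ℕ) → Form (ap n) true) λ φ →
    (Σ ℕ λ c → ∀ n → 1 ≤ n → size (φ n) ≤ c * n) ×
    (Σ ℕ λ a → 1 ≤ a × Σ ℕ λ N → ∀ n → N ≤ n →
    (ψ : Form (ap n) false) → Equiv (φ n) ψ → 2 ^ n ≤ size ψ ^ a)
theorem5p6 = suc , functional , (61 , size-functional) ,
  -- Exponent 2 amounts to the lower bound `2 ^ (n / 2)` on `size ψ`. This inequality of naturals is
  -- decidable, so it may be proved by refuting its negation, which also absorbs the double negation
  -- of `agreeing-pair`.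
  2 , s≤s z≤n , 2 , λ n 2≤n ψ equiv →
    decidable-stable (2 ^ n ≤? size ψ ^ 2) λ large →
      agreeing-pair ψ (tableWord n) (2 ^ n) (few-types n (size ψ) 2≤n large) λ (S , T , S<T , agree) →
        Fin-<⇒≢ S<T (spliced-functional n S T (to (models-functional _)
          (from (equiv _) (splice-models (2 ^ n) (tableWord n S) (tableWord n T) ψ agree
            (to (equiv _) (from (models-functional _) (tableWord-functional n S)))))))
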